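{- Let $\mathbf v\in\mathbb Z^4$ be nonzero and $\mathcal A[\mathbf v]=\{\mathbf U\mathbf v:\mathbf U\in\mathcal A\}$. (1) If $\mathcal A[\mathbf v]$ contains an exceptional quadruple, then it contains elements $\mathbf v_1,\mathbf v_2$ with $L(\mathbf v_1)>0$ and $L(\mathbf v_2)<0$. (2) There exist orbits $\mathcal A[\mathbf v]$ containing more than one exceptional quadruple. (3) Exceptional quadruples $\mathbf a$ with $Q_{\mathcal D}(\mathbf a)=k$ exist only for $k\ge1$; for each $k\ge1$ there are only finitely many exceptional quadruples $\mathbf a$ with $Q_{\mathcal D}(\mathbf a)=k$, and all satisfy $H(\mathbf a)^2\le 2k^2$.
   Context: $Q_{\mathcal D}(a,b,c,d)=2(a^2+b^2+c^2+d^2)-(a+b+c+d)^2$; $H(\mathbf a)=(a^2+b^2+c^2+d^2)^{1/2}$; $L(\mathbf a)=a+b+c+d$; $|\mathbf a|=|a|+|b|+|c|+|d|$. $\mathbf S_i$ ($i=1,\dots,4$) is the integer matrix replacing the $i$-th coordinate $a_i$ of a quadruple by $2\sum_{j\ne i}a_j-a_i$, other coordinates fixed; the Apollonian group $\mathcal A$ is the subgroup of $GL(4,\mathbb Z)$ they generate. An integer quadruple is reduced if no $\mathbf S_i$ strictly decreases $|\cdot|$. A reduced quadruple ordered as $a\le b\le c\le d$ with $L\ge0$ is exceptional if $a+b+c\le 0<d$ (and a root quadruple if $a+b+c\ge d>0$); a reduced quadruple with $L<0$ is exceptional iff $(-d,-c,-b,-a)$ is. -}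

module Defs where

open import Data.Bool using (if_then_else_)
open import Data.Fin using (Fin; _≟_)
open import Data.Integer using (ℤ; +_; -_; 0ℤ; 1ℤ; -1ℤ; _+_; _-_; _*_; _≤_; _<_; ∣_∣)
open import Data.List using (List)
open import Data.List.Membership.Propositional using (_∈_)
open import Data.List.Relation.Binary.Permutation.Propositional using (_↭_)
import Data.Nat as ℕ
open import Data.Product using (Σ; ∃-syntax; _×_)
open import Data.Vec using (Vec; []; _∷_; foldr′; map; replicate; tabulate; toList; transpose; zipWith)
open import Function using (_⇔_)
open import Relation.Binary.PropositionalEquality using (_≡_)
open import Relation.Nullary using (¬_)
open import Relation.Nullary.Decidable using (⌊_⌋)

Quadruple : Set
Quadruple = Vec ℤ 4

𝟎 : Quadruple
𝟎 = replicate 4 0ℤ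

Q𝒟 : Quadruple → ℤ
Q𝒟 (a ∷ b ∷ c ∷ d ∷ []) =
  + 2 * (a * a + b * b + c * c + d * d) - (a + b + c + d) * (a + b + c + d)

-- The square of the Euclidean height H; H itself is irrational in general.
H² : Quadruple → ℤ
H² (a ∷ b ∷ c ∷ d ∷ []) = a * a + b * b + c * c + d * d

L : Quadruple → ℤ
L (a ∷ b ∷ c ∷ d ∷ []) = a + b + c + d

‖_‖ : Quadruple → ℕ.ℕ
‖ a ∷ b ∷ c ∷ d ∷ [] ‖ = ∣ a ∣ ℕ.+ ∣ b ∣ ℕ.+ ∣ c ∣ ℕ.+ ∣ d ∣

-- Matrices are vectors of rows; quadruples are column vectors.
Matrix : Set
Matrix = Vec (Vec ℤ 4) 4

infixl 7 _·_ _⊗_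
infixr 6 _▷_

_·_ : Quadruple → Quadruple → ℤ
u · v = foldr′ _+_ 0ℤ (zipWith _*_ u v)

_▷_ : Matrix → Quadruple → Quadruple
M ▷ v = map (_· v) M

_⊗_ : Matrix → Matrix → Matrix
M ⊗ N = map (λ row → map (row ·_) (transpose N)) M

𝟏 : Matrix
𝟏 = tabulate λ r → tabulate λ c → if ⌊ r ≟ c ⌋ then 1ℤ else 0ℤ

-- The identity matrix with row i replaced by -1 on the diagonal and 2 elsewhere.
S : Fin 4 → Matrix
S i = tabulate λ r → tabulate λ c →
  if ⌊ r ≟ i ⌋
  then (if ⌊ c ≟ i ⌋ then -1ℤ else + 2)
  else (if ⌊ r ≟ c ⌋ then 1ℤ else 0ℤ)

-- Membership in the subgroup of GL(4,ℤ) generated by the S i.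
data 𝒜 : Matrix → Set where
  gen : ∀ i → 𝒜 (S i)
  one : 𝒜 𝟏
  mul : ∀ {U V} → 𝒜 U → 𝒜 V → 𝒜 (U ⊗ V)
  inv : ∀ {U V} → 𝒜 U → U ⊗ V ≡ 𝟏 → V ⊗ U ≡ 𝟏 → 𝒜 V

infix 4 _∈𝒜[_] _≈ₚ_

_∈𝒜[_] : Quadruple → Quadruple → Set
w ∈𝒜[ v ] = ∃[ U ] (𝒜 U × w ≡ U ▷ v)

Reduced : Quadruple → Set
Reduced v = ∀ i → ¬ (‖ S i ▷ v ‖ ℕ.< ‖ v ‖)

_≈ₚ_ : Quadruple → Quadruple → Set
v ≈ₚ w = toList v ↭ toList w

Ordered : Quadruple → Set
Ordered (a ∷ b ∷ c ∷ d ∷ []) = a ≤ b × b ≤ c × c ≤ d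

data OrderedExceptional : Quadruple → Set where
  nonneg : ∀ {a b c d} → let v = a ∷ b ∷ c ∷ d ∷ [] in
           Reduced v → Ordered v → 0ℤ ≤ L v →
           a + b + c ≤ 0ℤ → 0ℤ < d →
           OrderedExceptional v
  neg    : ∀ {a b c d} → let v = a ∷ b ∷ c ∷ d ∷ [] in
           Reduced v → Ordered v → L v < 0ℤ →
           OrderedExceptional (- d ∷ - c ∷ - b ∷ - a ∷ []) →
           OrderedExceptional v

-- Orbits are not closed under reordering coordinates, so a quadruple counts as
-- exceptional when its increasing rearrangement is.
Exceptional : Quadruple → Set
Exceptional v = ∃[ w ] (w ≈ₚ v × OrderedExceptional w)

Finite : (Quadruple → Set) → Set
Finite P = Σ (List Quadruple) λ xs → ∀ v → v ∈ xs ⇔ P v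

{-# OPTIONS --safe #-}

-- For an increasing quadruple with p = -(a+b+c) ≥ 0, d > 0 and L = d - p ≥ 0,
--   Q = 2(a² + b² + c²) + d + d(d - 1) + p(d + L)
-- is a sum of nonnegative terms, so Q ≥ d ≥ 1 and Q ≥ 2(a² + b² + c²); together
-- these give H² ≤ Q + Q² ≤ 2Q². Finiteness follows because H² bounds the entries
-- and being exceptional is decidable.
--
-- For the orbits, reflecting an entry x by S i turns L into 3L - 4x. Taking x = d
-- gives -(3p + d) < 0; if L = 0 then a < 0 and taking x = a gives -4a > 0.
-- Quadruples with L < 0 are symmetric under negation.
module Submission where

open import Defs
open import Data.Fin using (Fin; zero; suc)
import Data.Fin.Properties as Fin
open import Data.Integer using (ℤ; +_; -[1+_]; -_; 0ℤ; 1ℤ; -1ℤ; _+_; _-_; _*_; _≤_; _<_; +≤+; ∣_∣)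
open import Data.Integer.Properties as ℤ using (_≟_; _≤?_; _<?_)
open import Data.Integer.Solver using (module +-*-Solver)
open import Data.Integer.Tactic.RingSolver using (solve-∀)
open import Data.List using (List; []; _∷_; _++_; [_]; foldr; map; filter; upTo; cartesianProductWith)
import Data.List.Membership.DecPropositional as DecMembership
open import Data.List.Membership.Propositional using (_∈_; find; lose)
open import Data.List.Membership.Propositional.Properties
open import Data.List.Relation.Binary.Permutation.Propositional using (_↭_; refl; prep; ↭-sym; ↭-trans; ↭⇒↭ₛ)
open import Data.List.Relation.Binary.Permutation.Propositional.Properties
open import Data.List.Relation.Binary.Permutation.Setoid.Properties using (foldr-commMonoid)
open import Data.List.Relation.Unary.Any using (here; there; any?)
import Data.Nat as ℕ
import Data.Nat.Properties as ℕ
open import Data.Product using (∃-syntax; _×_; _,_; proj₁; proj₂)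
open import Data.Sum using (_⊎_; inj₁; inj₂)
open import Data.Vec as Vec using (Vec; []; _∷_; toList; lookup; transpose; zipWith; foldr′)
import Data.Vec.Properties as Vec
open import Data.Vec.Membership.Propositional.Properties using (∈-toList⁻)
import Data.Vec.Relation.Unary.Any as VecAny
import Data.Vec.Relation.Unary.Any.Properties as VecAny
open import Function using (_∘_; mk⇔)
open import Relation.Binary.Definitions using (DecidableEquality)
open import Relation.Binary.PropositionalEquality using (_≡_; _≢_; refl; sym; trans; cong; cong₂; subst; setoid)
open import Relation.Nullary using (¬_; Dec; yes; no; ¬?; contradiction)
open import Relation.Nullary.Decidable using (map′; _×-dec_; _⊎-dec_; from-yes)

-- Inequalities over ℤ

0≤+ : ∀ n → 0ℤ ≤ + n
0≤+ n = +≤+ ℕ.z≤n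

0≤i*j : ∀ {i j} → 0ℤ ≤ i → 0ℤ ≤ j → 0ℤ ≤ i * j
0≤i*j (+≤+ {n = m} _) (+≤+ {n = n} _) = subst (0ℤ ≤_) (ℤ.pos-* m n) (0≤+ (m ℕ.* n))

0≤i*i : ∀ i → 0ℤ ≤ i * i
0≤i*i (+ n)    = 0≤i*j {+ n} {+ n} (0≤+ n) (0≤+ n)
0≤i*i -[1+ n ] = 0≤+ _

0≤i+j : ∀ {i j} → 0ℤ ≤ i → 0ℤ ≤ j → 0ℤ ≤ i + j
0≤i+j = ℤ.+-mono-≤

j-i≡k≥0⇒i≤j : ∀ {i j k} → j - i ≡ k → 0ℤ ≤ k → i ≤ j
j-i≡k≥0⇒i≤j eq 0≤k = ℤ.0≤i-j⇒j≤i (subst (0ℤ ≤_) (sym eq) 0≤k)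

-- A coarse bound that avoids square roots: the absolute value of an integer never exceeds its
-- square.
i*i≤j⇒∣i∣≤∣j∣ : ∀ i {j} → i * i ≤ j → ∣ i ∣ ℕ.≤ ∣ j ∣
i*i≤j⇒∣i∣≤∣j∣ i {j} i*i≤j = begin
  ∣ i ∣             ≤⟨ m≤m*m ∣ i ∣ ⟩
  ∣ i ∣ ℕ.* ∣ i ∣   ≡⟨ ℤ.abs-* i i ⟨
  ∣ i * i ∣         ≤⟨ ∣∣-mono (0≤i*i i) i*i≤j ⟩
  ∣ j ∣             ∎
  where
  open ℕ.≤-Reasoning
  m≤m*m : ∀ m → m ℕ.≤ m ℕ.* m
  m≤m*m ℕ.zero    = ℕ.z≤n
  m≤m*m (ℕ.suc m) = ℕ.m≤m*n (ℕ.suc m) (ℕ.suc m)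
  ∣∣-mono : ∀ {i j} → 0ℤ ≤ i → i ≤ j → ∣ i ∣ ℕ.≤ ∣ j ∣
  ∣∣-mono (+≤+ _) (+≤+ m≤n) = m≤n

-- Matrix action and orbits

module _ where
  open +-*-Solver

  -- Built like _·_, so that solver expressions evaluate definitionally to matrix products.
  _·ₚ_ : ∀ {n} → Vec (Polynomial n) 4 → Vec (Polynomial n) 4 → Polynomial n
  u ·ₚ v = foldr′ _:+_ (con 0ℤ) (zipWith _:*_ u v)

  ·-⊗ : ∀ r N v → Vec.map (r ·_) (transpose N) · v ≡ r · (N ▷ v)
  ·-⊗ (x₁ ∷ x₂ ∷ x₃ ∷ x₄ ∷ [])
      ((a₁ ∷ a₂ ∷ a₃ ∷ a₄ ∷ []) ∷ (b₁ ∷ b₂ ∷ b₃ ∷ b₄ ∷ []) ∷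
       (c₁ ∷ c₂ ∷ c₃ ∷ c₄ ∷ []) ∷ (d₁ ∷ d₂ ∷ d₃ ∷ d₄ ∷ []) ∷ [])
      (v₁ ∷ v₂ ∷ v₃ ∷ v₄ ∷ []) =
    solve 24
      (λ x₁ x₂ x₃ x₄ a₁ a₂ a₃ a₄ b₁ b₂ b₃ b₄ c₁ c₂ c₃ c₄ d₁ d₂ d₃ d₄ v₁ v₂ v₃ v₄ →
        let r = x₁ ∷ x₂ ∷ x₃ ∷ x₄ ∷ []
            N = (a₁ ∷ a₂ ∷ a₃ ∷ a₄ ∷ []) ∷ (b₁ ∷ b₂ ∷ b₃ ∷ b₄ ∷ []) ∷
                (c₁ ∷ c₂ ∷ c₃ ∷ c₄ ∷ []) ∷ (d₁ ∷ d₂ ∷ d₃ ∷ d₄ ∷ []) ∷ []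
            v = v₁ ∷ v₂ ∷ v₃ ∷ v₄ ∷ []
        in (Vec.map (r ·ₚ_) (transpose N) ·ₚ v) := (r ·ₚ Vec.map (_·ₚ v) N))
      refl
      x₁ x₂ x₃ x₄ a₁ a₂ a₃ a₄ b₁ b₂ b₃ b₄ c₁ c₂ c₃ c₄ d₁ d₂ d₃ d₄ v₁ v₂ v₃ v₄

  -- Only the entry x at `i` changes, to 2(L - x) - x, which adds 2L - 4x to the sum.
  L-S : ∀ i v → L (S i ▷ v) ≡ + 3 * L v - + 4 * lookup v i
  L-S i (a ∷ b ∷ c ∷ d ∷ []) = go i a b c d
    where
    Lₚ : ∀ {n} → Vec (Polynomial n) 4 → Polynomial n
    Lₚ (a ∷ b ∷ c ∷ d ∷ []) = a :+ b :+ c :+ d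

    equation : Fin 4 → (a b c d : Polynomial 4) → Polynomial 4 × Polynomial 4
    equation i a b c d =
      let v = a ∷ b ∷ c ∷ d ∷ []
      -- The rows of `S i` enter as constants, so `i` has to be concrete for them to evaluate; hence
      -- the four cases of `go`.
      in Lₚ (Vec.map (λ r → Vec.map con r ·ₚ v) (S i)) := con (+ 3) :* Lₚ v :- con (+ 4) :* lookup v i

    go : ∀ i a b c d → let v = a ∷ b ∷ c ∷ d ∷ [] in
         L (S i ▷ v) ≡ + 3 * L v - + 4 * lookup v i
    go zero                   = solve 4 (equation zero) refl
    go (suc zero)             = solve 4 (equation (suc zero)) refl
    go (suc (suc zero))       = solve 4 (equation (suc (suc zero))) refl
    go (suc (suc (suc zero))) = solve 4 (equation (suc (suc (suc zero)))) refl

⊗-▷ : ∀ M N v → M ⊗ N ▷ v ≡ M ▷ N ▷ v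
⊗-▷ M N v = trans (sym (Vec.map-∘ (_· v) _ M)) (Vec.map-cong (λ r → ·-⊗ r N v) M)

S▷-∈𝒜 : ∀ i {v w} → w ∈𝒜[ v ] → S i ▷ w ∈𝒜[ v ]
S▷-∈𝒜 i {v} (U , U∈𝒜 , refl) = S i ⊗ U , mul (gen i) U∈𝒜 , sym (⊗-▷ (S i) U v)

∈toList⇒lookup : ∀ {x : ℤ} {n} (v : Vec ℤ n) → x ∈ toList v → ∃[ i ] x ≡ lookup v i
∈toList⇒lookup v x∈v = VecAny.index x∈′ , VecAny.lookup-index x∈′
  where x∈′ = ∈-toList⁻ x∈v

-- Permutation invariance

sumℤ : List ℤ → ℤ
sumℤ = foldr _+_ 0ℤ

sumℤ-↭ : ∀ {xs ys} → xs ↭ ys → sumℤ xs ≡ sumℤ ys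
sumℤ-↭ p = foldr-commMonoid (setoid ℤ) ℤ.+-0-isCommutativeMonoid (↭⇒↭ₛ p)

sumℤ-4 : ∀ a b c d → a + b + c + d ≡ a + (b + (c + (d + 0ℤ)))
sumℤ-4 = solve-∀

L≡sumℤ : ∀ v → L v ≡ sumℤ (toList v)
L≡sumℤ (a ∷ b ∷ c ∷ d ∷ []) = sumℤ-4 a b c d

H²≡sumℤ : ∀ v → H² v ≡ sumℤ (map (λ x → x * x) (toList v))
H²≡sumℤ (a ∷ b ∷ c ∷ d ∷ []) = sumℤ-4 (a * a) (b * b) (c * c) (d * d)

-- Reduces the invariance of `Q𝒟` under permutation and reflection to the behaviour of `H²` and `L`.
Q𝒟≡2H²-L² : ∀ v → Q𝒟 v ≡ + 2 * H² v - L v * L v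
Q𝒟≡2H²-L² (a ∷ b ∷ c ∷ d ∷ []) = refl

L-↭ : ∀ {v w} → v ≈ₚ w → L v ≡ L w
L-↭ {v} {w} p = trans (L≡sumℤ v) (trans (sumℤ-↭ p) (sym (L≡sumℤ w)))

H²-↭ : ∀ {v w} → v ≈ₚ w → H² v ≡ H² w
H²-↭ {v} {w} p = trans (H²≡sumℤ v) (trans (sumℤ-↭ (map⁺ _ p)) (sym (H²≡sumℤ w)))

Q𝒟-↭ : ∀ {v w} → v ≈ₚ w → Q𝒟 v ≡ Q𝒟 w
Q𝒟-↭ {v} {w} p = trans (Q𝒟≡2H²-L² v)
  (trans (cong₂ (λ h l → + 2 * h - l * l) (H²-↭ {v} {w} p) (L-↭ {v} {w} p)) (sym (Q𝒟≡2H²-L² w)))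

-- Exceptional quadruples by the sign of L

-- Together with `NegExceptional`, a recursion-free form of `OrderedExceptional`, decidable
-- component by component.
NonnegExceptional : Quadruple → Set
NonnegExceptional v@(a ∷ b ∷ c ∷ d ∷ []) =
  Reduced v × Ordered v × 0ℤ ≤ L v × a + b + c ≤ 0ℤ × 0ℤ < d

reflect : Quadruple → Quadruple
reflect (a ∷ b ∷ c ∷ d ∷ []) = - d ∷ - c ∷ - b ∷ - a ∷ []

NegExceptional : Quadruple → Set
NegExceptional v = Reduced v × Ordered v × L v < 0ℤ × NonnegExceptional (reflect v)

L-reflect : ∀ v → L (reflect v) ≡ - L v
L-reflect (a ∷ b ∷ c ∷ d ∷ []) = go a b c d
  where
  go : ∀ a b c d → - d + - c + - b + - a ≡ - (a + b + c + d)
  go = solve-∀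

H²-reflect : ∀ v → H² (reflect v) ≡ H² v
H²-reflect (a ∷ b ∷ c ∷ d ∷ []) = go a b c d
  where
  go : ∀ a b c d → (- d) * (- d) + (- c) * (- c) + (- b) * (- b) + (- a) * (- a) ≡ a * a + b * b + c * c + d * d
  go = solve-∀

Q𝒟-reflect : ∀ v → Q𝒟 (reflect v) ≡ Q𝒟 v
Q𝒟-reflect v = trans (Q𝒟≡2H²-L² (reflect v))
  (trans (cong₂ (λ h l → + 2 * h - l) (H²-reflect v) L²) (sym (Q𝒟≡2H²-L² v)))
  where
  neg² : ∀ x → (- x) * (- x) ≡ x * x
  neg² = solve-∀
  L² : L (reflect v) * L (reflect v) ≡ L v * L v
  L² = trans (cong (λ l → l * l) (L-reflect v)) (neg² (L v))

OrderedExceptional⇒ : ∀ {v} → OrderedExceptional v → NonnegExceptional v ⊎ NegExceptional v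
OrderedExceptional⇒ (nonneg r o l s d) = inj₁ (r , o , l , s , d)
OrderedExceptional⇒ (neg r o l (nonneg r′ o′ l′ s d)) = inj₂ (r , o , l , r′ , o′ , l′ , s , d)
-- Two nested uses of `neg` would make `L` negative both before and after a reflection, which
-- negates it.
OrderedExceptional⇒ (neg {a} {b} {c} {d} r o l (neg _ _ l′ _)) =
  contradiction l′ (ℤ.<-asym (subst (0ℤ <_) (sym (L-reflect (a ∷ b ∷ c ∷ d ∷ []))) (ℤ.neg-mono-< l)))

OrderedExceptional⇐ : ∀ {v} → NonnegExceptional v ⊎ NegExceptional v → OrderedExceptional v
OrderedExceptional⇐ {_ ∷ _ ∷ _ ∷ _ ∷ []} (inj₁ (r , o , l , s , d)) = nonneg r o l s d
OrderedExceptional⇐ {_ ∷ _ ∷ _ ∷ _ ∷ []} (inj₂ (r , o , l , r′ , o′ , l′ , s , d)) =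
  neg r o l (nonneg r′ o′ l′ s d)

-- Bounds on Q𝒟 and H²

HeightBound : ℤ → ℤ → Set
HeightBound q h = 1ℤ ≤ q × h ≤ + 2 * (q * q)

nonneg-bound : ∀ v → NonnegExceptional v → HeightBound (Q𝒟 v) (H² v)
nonneg-bound v@(a ∷ b ∷ c ∷ d ∷ []) (_ , _ , 0≤L , s≤0 , 0<d) = 1≤Q , H²≤2Q²
  where
  T p : ℤ
  T = a * a + b * b + c * c
  -- Written as a difference so that `ℤ.i≤j⇒0≤j-i` applied to `s≤0` gives 0 ≤ p directly.
  p = 0ℤ - (a + b + c)

  1≤d : 1ℤ ≤ d
  1≤d = ℤ.i<j⇒suc[i]≤j 0<d

  0≤d : 0ℤ ≤ d
  0≤d = ℤ.<⇒≤ 0<d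

  0≤T : 0ℤ ≤ T
  0≤T = 0≤i+j (0≤i+j (0≤i*i a) (0≤i*i b)) (0≤i*i c)

  0≤p[d+L] : 0ℤ ≤ p * (d + L v)
  0≤p[d+L] = 0≤i*j (ℤ.i≤j⇒0≤j-i s≤0) (0≤i+j 0≤d 0≤L)

  Q-d : ∀ a b c d →
    (+ 2 * (a * a + b * b + c * c + d * d) - (a + b + c + d) * (a + b + c + d)) - d
    ≡ + 2 * (a * a + b * b + c * c) + d * (d - 1ℤ) + (0ℤ - (a + b + c)) * (d + (a + b + c + d))
  Q-d = solve-∀

  Q-2T : ∀ a b c d →
    (+ 2 * (a * a + b * b + c * c + d * d) - (a + b + c + d) * (a + b + c + d))
      - + 2 * (a * a + b * b + c * c)
    ≡ d * d + (0ℤ - (a + b + c)) * (d + (a + b + c + d))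
  Q-2T = solve-∀

  d≤Q : d ≤ Q𝒟 v
  d≤Q = j-i≡k≥0⇒i≤j (Q-d a b c d)
    (0≤i+j (0≤i+j (0≤i*j (0≤+ 2) 0≤T) (0≤i*j 0≤d (ℤ.i≤j⇒0≤j-i 1≤d))) 0≤p[d+L])

  2T≤Q : + 2 * T ≤ Q𝒟 v
  2T≤Q = j-i≡k≥0⇒i≤j (Q-2T a b c d) (0≤i+j (0≤i*i d) 0≤p[d+L])

  1≤Q : 1ℤ ≤ Q𝒟 v
  1≤Q = ℤ.≤-trans 1≤d d≤Q

  0≤Q : 0ℤ ≤ Q𝒟 v
  0≤Q = ℤ.≤-trans 0≤d d≤Q

  -- Split so that the summands are nonnegative by d ≤ q, 1 ≤ q, 2t ≤ q and 0 ≤ t respectively.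
  2q²-[t+d²] : ∀ q t d →
    + 2 * (q * q) - (t + d * d) ≡ (q - d) * (q + d) + q * (q - 1ℤ) + (q - + 2 * t) + t
  2q²-[t+d²] = solve-∀

  H²≤2Q² : H² v ≤ + 2 * (Q𝒟 v * Q𝒟 v)
  H²≤2Q² = j-i≡k≥0⇒i≤j (2q²-[t+d²] (Q𝒟 v) T d)
    (0≤i+j (0≤i+j (0≤i+j
      (0≤i*j (ℤ.i≤j⇒0≤j-i d≤Q) (0≤i+j 0≤Q 0≤d))
      (0≤i*j 0≤Q (ℤ.i≤j⇒0≤j-i 1≤Q)))
      (ℤ.i≤j⇒0≤j-i 2T≤Q))
      0≤T)

exceptional-bound : ∀ v → Exceptional v → HeightBound (Q𝒟 v) (H² v)
exceptional-bound v (w , w≈v , exc)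
  rewrite sym (Q𝒟-↭ {w} {v} w≈v) | sym (H²-↭ {w} {v} w≈v) with OrderedExceptional⇒ exc
... | inj₁ nn = nonneg-bound w nn
... | inj₂ (_ , _ , _ , nn) rewrite sym (Q𝒟-reflect w) | sym (H²-reflect w) =
  nonneg-bound (reflect w) nn

-- Sign changes of L along an orbit

-- Either `L` already has the wanted sign or, by `L-S`, one reflection of an entry x produces it.
-- Naming x by membership instead of by index makes the condition stable under reordering.
CanRise CanFall : Quadruple → Set
CanRise v = 0ℤ < L v ⊎ ∃[ x ] (x ∈ toList v × 0ℤ < + 3 * L v - + 4 * x)
CanFall v = L v < 0ℤ ⊎ ∃[ x ] (x ∈ toList v × + 3 * L v - + 4 * x < 0ℤ)

CanRise-↭ : ∀ {v w} → v ≈ₚ w → CanRise v → CanRise w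
CanRise-↭ {v} {w} p h rewrite L-↭ {v} {w} p with h
... | inj₁ 0<L            = inj₁ 0<L
... | inj₂ (x , x∈v , 0<) = inj₂ (x , ∈-resp-↭ p x∈v , 0<)

CanFall-↭ : ∀ {v w} → v ≈ₚ w → CanFall v → CanFall w
CanFall-↭ {v} {w} p h rewrite L-↭ {v} {w} p with h
... | inj₁ L<0            = inj₁ L<0
... | inj₂ (x , x∈v , <0) = inj₂ (x , ∈-resp-↭ p x∈v , <0)

CanRise⇒∈𝒜 : ∀ {u v} → v ∈𝒜[ u ] → CanRise v → ∃[ w ] (w ∈𝒜[ u ] × 0ℤ < L w)
CanRise⇒∈𝒜 v∈ (inj₁ 0<L) = _ , v∈ , 0<L
CanRise⇒∈𝒜 {v = v} v∈ (inj₂ (x , x∈v , 0<)) with i , refl ← ∈toList⇒lookup v x∈v =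
  _ , S▷-∈𝒜 i v∈ , subst (0ℤ <_) (sym (L-S i v)) 0<

CanFall⇒∈𝒜 : ∀ {u v} → v ∈𝒜[ u ] → CanFall v → ∃[ w ] (w ∈𝒜[ u ] × L w < 0ℤ)
CanFall⇒∈𝒜 v∈ (inj₁ L<0) = _ , v∈ , L<0
CanFall⇒∈𝒜 {v = v} v∈ (inj₂ (x , x∈v , <0)) with i , refl ← ∈toList⇒lookup v x∈v =
  _ , S▷-∈𝒜 i v∈ , subst (_< 0ℤ) (sym (L-S i v)) <0

nonneg-rise : ∀ v → NonnegExceptional v → CanRise v
nonneg-rise v@(a ∷ b ∷ c ∷ d ∷ []) (_ , (a≤b , b≤c , _) , 0≤L , _ , 0<d) with 0ℤ <? L v
... | yes 0<L = inj₁ 0<L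
... | no  0≮L = inj₂ (a , here refl , subst (0ℤ <_) (shuffle (L v) a)
  (ℤ.+-mono-≤-< (0≤i*j (0≤+ 3) 0≤L) (ℤ.*-monoˡ-<-pos (+ 4) (ℤ.neg-mono-< a<0))))
  where
  a<0 : a < 0ℤ
  -- If the least entry were nonnegative, so would be a, b and c, and 0 < d would force 0 < L.
  a<0 = ℤ.≰⇒> λ 0≤a → let 0≤b = ℤ.≤-trans 0≤a a≤b in
    0≮L (ℤ.+-mono-≤-< (0≤i+j (0≤i+j 0≤a 0≤b) (ℤ.≤-trans 0≤b b≤c)) 0<d)
  shuffle : ∀ l a → + 3 * l + + 4 * (- a) ≡ + 3 * l - + 4 * a
  shuffle = solve-∀

nonneg-fall : ∀ v → NonnegExceptional v → CanFall v
nonneg-fall (a ∷ b ∷ c ∷ d ∷ []) (_ , _ , _ , s≤0 , 0<d) =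
  inj₂ (d , there (there (there (here refl))) , subst (_< 0ℤ) (shuffle a b c d)
    (ℤ.neg-mono-< (ℤ.+-mono-≤-< (0≤i*j (0≤+ 3) (ℤ.i≤j⇒0≤j-i s≤0)) 0<d)))
  where
  shuffle : ∀ a b c d →
    - (+ 3 * (0ℤ - (a + b + c)) + d) ≡ + 3 * (a + b + c + d) - + 4 * d
  shuffle = solve-∀

-- The mirror image of `nonneg-fall`: `- a` is the greatest entry of `reflect v`, and 3L - 4a = 3(b
-- + c + d) - a with b + c + d ≥ 0 and - a > 0.
neg-rise : ∀ v → NegExceptional v → CanRise v
neg-rise (a ∷ b ∷ c ∷ d ∷ []) (_ , _ , _ , _ , _ , _ , s≤0 , 0<-a) =
  inj₂ (a , here refl , subst (0ℤ <_) (shuffle a b c d)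
    (ℤ.+-mono-≤-< (0≤i*j (0≤+ 3) (ℤ.i≤j⇒0≤j-i s≤0)) 0<-a))
  where
  shuffle : ∀ a b c d →
    + 3 * (0ℤ - (- d + - c + - b)) + (- a) ≡ + 3 * (a + b + c + d) - + 4 * a
  shuffle = solve-∀

exceptional-rise-fall : ∀ v → Exceptional v → CanRise v × CanFall v
exceptional-rise-fall v (w , w≈v , exc) with OrderedExceptional⇒ exc
... | inj₁ nn = CanRise-↭ {w} {v} w≈v (nonneg-rise w nn) , CanFall-↭ {w} {v} w≈v (nonneg-fall w nn)
... | inj₂ ng@(_ , _ , L<0 , _) =
  CanRise-↭ {w} {v} w≈v (neg-rise w ng) , CanFall-↭ {w} {v} w≈v (inj₁ L<0)

-- Decidability and finiteness

module _ {A : Set} (_≟ᴬ_ : DecidableEquality A) where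
  open DecMembership _≟ᴬ_ using (_∈?_)

  _↭?_ : (xs ys : List A) → Dec (xs ↭ ys)
  []       ↭? []       = yes refl
  []       ↭? (y ∷ ys) = no (¬x∷xs↭[] ∘ ↭-sym)
  (x ∷ xs) ↭? ys with x ∈? ys
  ... | no  x∉ys = no λ p → x∉ys (∈-resp-↭ p (here refl))
  ... | yes x∈ys with hs , ts , refl ← ∈-∃++ x∈ys =
    -- Any occurrence of x in `ys` may be cancelled: `drop-mid` shows that the choice does not
    -- affect the answer.
    map′ (λ p → ↭-trans (prep x p) (↭-sym (shift x hs ts))) (drop-mid [] hs) (xs ↭? (hs ++ ts))

vecsOver : ∀ {A : Set} → List A → ∀ n → List (Vec A n)
vecsOver xs ℕ.zero    = [ [] ]
vecsOver xs (ℕ.suc n) = cartesianProductWith _∷_ xs (vecsOver xs n)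

∈-vecsOver : ∀ {A : Set} {xs : List A} {n} (v : Vec A n) →
             (∀ {x} → x ∈ toList v → x ∈ xs) → v ∈ vecsOver xs n
∈-vecsOver []      _   = here refl
∈-vecsOver (x ∷ v) v⊆xs =
  ∈-cartesianProductWith⁺ _∷_ (v⊆xs (here refl)) (∈-vecsOver v (v⊆xs ∘ there))

-- `upTo` excludes its bound, hence `ℕ.suc n`. Zero is listed twice, which is harmless since
-- `Finite` concerns membership only.
interval : ℕ.ℕ → List ℤ
interval n = map +_ (upTo (ℕ.suc n)) ++ map (-_ ∘ +_) (upTo (ℕ.suc n))

∈-interval : ∀ {n} i → ∣ i ∣ ℕ.≤ n → i ∈ interval n
∈-interval (+ m)    m≤n = ∈-++⁺ˡ (∈-map⁺ +_ (∈-upTo⁺ (ℕ.s≤s m≤n)))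
∈-interval {n} -[1+ m ] m<n =
  ∈-++⁺ʳ (map +_ (upTo (ℕ.suc n))) (∈-map⁺ (-_ ∘ +_) (∈-upTo⁺ (ℕ.s≤s m<n)))

Reduced? : ∀ v → Dec (Reduced v)
Reduced? v = Fin.all? λ i → ¬? (‖ S i ▷ v ‖ ℕ.<? ‖ v ‖)

Ordered? : ∀ v → Dec (Ordered v)
Ordered? (a ∷ b ∷ c ∷ d ∷ []) = a ≤? b ×-dec b ≤? c ×-dec c ≤? d

NonnegExceptional? : ∀ v → Dec (NonnegExceptional v)
NonnegExceptional? v@(a ∷ b ∷ c ∷ d ∷ []) =
  Reduced? v ×-dec Ordered? v ×-dec 0ℤ ≤? L v ×-dec a + b + c ≤? 0ℤ ×-dec 0ℤ <? d

NegExceptional? : ∀ v → Dec (NegExceptional v)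
NegExceptional? v =
  Reduced? v ×-dec Ordered? v ×-dec L v <? 0ℤ ×-dec NonnegExceptional? (reflect v)

OrderedExceptional? : ∀ v → Dec (OrderedExceptional v)
OrderedExceptional? v =
  map′ OrderedExceptional⇐ OrderedExceptional⇒ (NonnegExceptional? v ⊎-dec NegExceptional? v)

-- A rearrangement of v has its entries in toList v, so the search is finite.
Exceptional? : ∀ v → Dec (Exceptional v)
Exceptional? v = map′
  (λ h → let w , _ , p = find h in w , p)
  (λ (w , w≈v , exc) → lose (∈-vecsOver w (∈-resp-↭ w≈v)) (w≈v , exc))
  (any? (λ w → _↭?_ _≟_ (toList w) (toList v) ×-dec OrderedExceptional? w) (vecsOver (toList v) 4))

x∈xs⇒x*x≤sum : ∀ {x} xs → x ∈ xs → x * x ≤ sumℤ (map (λ x → x * x) xs)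
x∈xs⇒x*x≤sum {x} (y ∷ xs) x∈ = go x∈
  where
  0≤sum : ∀ xs → 0ℤ ≤ sumℤ (map (λ x → x * x) xs)
  0≤sum []       = ℤ.≤-refl
  0≤sum (x ∷ xs) = 0≤i+j (0≤i*i x) (0≤sum xs)
  go : x ∈ y ∷ xs → x * x ≤ y * y + sumℤ (map (λ x → x * x) xs)
  go (here refl)  = subst (_≤ x * x + sumℤ (map (λ x → x * x) xs)) (ℤ.+-identityʳ _) (ℤ.+-monoʳ-≤ (x * x) (0≤sum xs))
  go (there x∈xs) = subst (_≤ _) (ℤ.+-identityˡ _) (ℤ.+-mono-≤ (0≤i*i y) (x∈xs⇒x*x≤sum xs x∈xs))

-- Each entry x satisfies x² ≤ H² ≤ h, so `P` holds only inside a finite box, which `P?` then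
-- filters.
H²-bounded-finite : ∀ {P : Quadruple → Set} → (∀ v → Dec (P v)) →
                    ∀ h → (∀ v → P v → H² v ≤ h) → Finite P
H²-bounded-finite {P} P? h P⇒H²≤h = filter P? box , λ v →
  mk⇔ (proj₂ ∘ ∈-filter⁻ P? {xs = box}) (λ Pv → ∈-filter⁺ P? (∈-box v (P⇒H²≤h v Pv)) Pv)
  where
  box : List Quadruple
  box = vecsOver (interval ∣ h ∣) 4
  ∈-box : ∀ v → H² v ≤ h → v ∈ box
  ∈-box v H²≤h = ∈-vecsOver v λ {x} x∈v → ∈-interval x (i*i≤j⇒∣i∣≤∣j∣ x
    (ℤ.≤-trans (x∈xs⇒x*x≤sum (toList v) x∈v) (subst (_≤ h) (H²≡sumℤ v) H²≤h)))

theorem3p4 : (∀ (v : Quadruple) → v ≢ 𝟎 →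
    ∃[ a ] (a ∈𝒜[ v ] × Exceptional a) →
    ∃[ v₁ ] ∃[ v₂ ] (v₁ ∈𝒜[ v ] × v₂ ∈𝒜[ v ] × 0ℤ < L v₁ × L v₂ < 0ℤ))
    × (∃[ v ] (v ≢ 𝟎 ×
    ∃[ a ] ∃[ b ] (a ∈𝒜[ v ] × b ∈𝒜[ v ] × Exceptional a × Exceptional b × ¬ (a ≈ₚ b))))
    × (∀ (k : ℤ) (a : Quadruple) → Exceptional a → Q𝒟 a ≡ k → 1ℤ ≤ k)
    × (∀ (k : ℤ) → 1ℤ ≤ k →
    Finite (λ a → Exceptional a × Q𝒟 a ≡ k)
    × (∀ (a : Quadruple) → Exceptional a → Q𝒟 a ≡ k → H² a ≤ + 2 * (k * k)))
theorem3p4 = sign-change , two-exceptional , Q≥1 , λ k _ →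
  -- The bound left as `_` is inferred from `H²≤2k²` to be `+ 2 * (k * k)`.
  H²-bounded-finite (λ v → Exceptional? v ×-dec Q𝒟 v ≟ k) _ (λ v (exc , eq) → H²≤2k² k v exc eq) ,
  H²≤2k² k
  where
  sign-change : ∀ v → v ≢ 𝟎 → ∃[ a ] (a ∈𝒜[ v ] × Exceptional a) →
    ∃[ v₁ ] ∃[ v₂ ] (v₁ ∈𝒜[ v ] × v₂ ∈𝒜[ v ] × 0ℤ < L v₁ × L v₂ < 0ℤ)
  sign-change v _ (a , a∈ , exc) =
    let rise , fall   = exceptional-rise-fall a exc
        v₁ , v₁∈ , 0< = CanRise⇒∈𝒜 a∈ rise
        v₂ , v₂∈ , <0 = CanFall⇒∈𝒜 a∈ fall
    in v₁ , v₂ , v₁∈ , v₂∈ , 0< , <0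

  two-exceptional : ∃[ v ] (v ≢ 𝟎 ×
    ∃[ a ] ∃[ b ] (a ∈𝒜[ v ] × b ∈𝒜[ v ] × Exceptional a × Exceptional b × ¬ (a ≈ₚ b)))
  two-exceptional = v , (λ ()) , v , w , (𝟏 , one , refl) , (S (suc zero) , gen (suc zero) , refl) ,
    from-yes (Exceptional? v) , from-yes (Exceptional? w) , λ v≈w → contradiction (L-↭ {v} {w} v≈w) λ ()
    where
    v w : Quadruple
    -- Replacing the second entry of `v` by 2(-1 + 0 + 1) - (-1) = 1 gives `w`, whose increasing
    -- rearrangement is `reflect v`. Evaluating the decision procedure certifies both as
    -- exceptional; their sums -1 and 1 rule out a permutation.
    v = -1ℤ ∷ -1ℤ ∷ 0ℤ ∷ 1ℤ ∷ []
    w = -1ℤ ∷ 1ℤ ∷ 0ℤ ∷ 1ℤ ∷ []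

  Q≥1 : ∀ k a → Exceptional a → Q𝒟 a ≡ k → 1ℤ ≤ k
  Q≥1 _ a exc refl = proj₁ (exceptional-bound a exc)

  H²≤2k² : ∀ k a → Exceptional a → Q𝒟 a ≡ k → H² a ≤ + 2 * (k * k)
  H²≤2k² _ a exc refl = proj₂ (exceptional-bound a exc)
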